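{- For all integers $t,s\ge 0$ and $m\ge 2$, there is a strong Bollobás $(t,s)$-system $(A_i,B_i)$, $1\le i\le m$, with exactly $m$ pairs such that, with $a_i=|A_i|$ and $b_i=|B_i|$, $$\sum_{i=1}^{m}\frac{\binom{b_i-t+s}{s}}{\binom{a_i+b_i-2t}{a_i-t}}=1.$$ There is also a corresponding equality system of coordinate subspaces over every field: for every field $\mathbb F$ there are a finite-dimensional $\mathbb F$-vector space with a fixed basis and exactly $m$ pairs $(A_i,B_i)$, $1\le i\le m$, of coordinate subspaces of it such that $\dim(A_i\cap B_i)\le t$ for all $i$, $\dim(A_i\cap B_j)>t+s$ for all $i\ne j$, and the displayed equality holds with $a_i=\dim A_i$, $b_i=\dim B_i$.
   Context: A strong Bollobás $(t,s)$-system is a family of pairs of finite sets $(A_i,B_i)$, $1\le i\le m$, satisfying $|A_i\cap B_i|\le t$ for all $i$ and $|A_i\cap B_j|>t+s$ for all $i\ne j$. A coordinate subspace of a vector space with a fixed basis is the span of a subset of that basis. -}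

module Defs where

open import Algebra.Apartness.Bundles using (HeytingField; HeytingCommutativeRing)
open import Algebra.Bundles using (CommutativeRing)
import Algebra.Definitions.RawMonoid as RawMonoidSum
open import Algebra.Module.Bundles using (Module)
open import Data.Fin.Base using (Fin)
open import Data.Fin.Subset using (Subset; _∈_; ∣_∣; _∩_)
open import Data.Integer.Base using (+_)
open import Data.Nat.Base using (ℕ; zero; suc; _+_; _*_; _∸_; _≤_; _<_)
open import Data.Nat.Combinatorics using (_C_)
open import Data.Product.Base using (Σ-syntax; ∃; ∃-syntax; _×_)
open import Data.Rational.Base using (ℚ; 0ℚ; _/_; +-0-rawMonoid)
open import Level using (Level; _⊔_)
open import Relation.Binary.PropositionalEquality.Core using (_≢_)
open import Relation.Unary using (Pred; U) renaming (_∩_ to _∩ₚ_)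

-- A zero denominator gives the junk value 0.
ratio : ℕ → ℕ → ℚ
ratio p zero      = 0ℚ
ratio p q@(suc _) = + p / q

-- In a strong Bollobás (t , s)-system with at least two pairs, a and b both
-- exceed t + s (A i contains A i ∩ B j for some j ≢ i, and likewise B i).
-- So no subtraction below is truncated and the denominator is positive.
weight : (t s a b : ℕ) → ℚ
weight t s a b = ratio (((b ∸ t) + s) C s) ((a + b ∸ 2 * t) C (a ∸ t))

weightSum : (t s : ℕ) {m : ℕ} (a b : Fin m → ℕ) → ℚ
weightSum t s a b = RawMonoidSum.sum +-0-rawMonoid (λ i → weight t s (a i) (b i))

-- Finitely many finite sets are represented as subsets of a common finite
-- ground set Fin n.
IsStrongBollobás : (t s : ℕ) {m n : ℕ} (A B : Fin m → Subset n) → Set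
IsStrongBollobás t s A B =
  (∀ i → ∣ A i ∩ B i ∣ ≤ t) ×
  (∀ i j → i ≢ j → t + s < ∣ A i ∩ B j ∣)

-- A Heyting field is a commutative ring with a tight apartness relation for
-- which x # y holds exactly when x - y is invertible.  Classically _#_ is
-- then the negation of _≈_, and this is a field in the usual sense
-- (1# ≉ 0# follows from the irreflexivity of _#_).
fieldRing : ∀ {c ℓ₁ ℓ₂} → HeytingField c ℓ₁ ℓ₂ → CommutativeRing c ℓ₁
fieldRing F = HeytingCommutativeRing.commutativeRing (HeytingField.heytingCommutativeRing F)

module LinearAlgebra {r ℓr m ℓm : Level} {K : CommutativeRing r ℓr}
                     (V : Module K m ℓm) where

  open CommutativeRing K using (0#; _≈_) renaming (Carrier to Scalar)
  open Module V using (_≈ᴹ_; _*ₗ_; 0ᴹ; +ᴹ-rawMonoid) renaming (Carrierᴹ to Vector)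

  linearCombination : ∀ {k} → (Fin k → Scalar) → (Fin k → Vector) → Vector
  linearCombination α v = RawMonoidSum.sum +ᴹ-rawMonoid (λ j → α j *ₗ v j)

  Span : ∀ {ℓ} → Pred Vector ℓ → Pred Vector (r ⊔ m ⊔ ℓm ⊔ ℓ)
  Span X x = ∃[ k ] Σ[ α ∈ (Fin k → Scalar) ] Σ[ v ∈ (Fin k → Vector) ]
    (∀ j → X (v j)) × x ≈ᴹ linearCombination α v

  Range : ∀ {k} → (Fin k → Vector) → Pred Vector ℓm
  Range v x = ∃[ j ] x ≈ᴹ v j

  LinearlyIndependent : ∀ {k} → (Fin k → Vector) → Set (r ⊔ ℓr ⊔ ℓm)
  LinearlyIndependent v =
    ∀ α → linearCombination α v ≈ᴹ 0ᴹ → ∀ j → α j ≈ 0#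

  IsBasisOf : ∀ {ℓ k} → Pred Vector ℓ → (Fin k → Vector) → Set (r ⊔ ℓr ⊔ m ⊔ ℓm ⊔ ℓ)
  IsBasisOf W v =
    (∀ j → W (v j)) × LinearlyIndependent v × (∀ x → W x → Span (Range v) x)

  IsBasis : ∀ {k} → (Fin k → Vector) → Set (r ⊔ ℓr ⊔ m ⊔ ℓm)
  IsBasis = IsBasisOf U

  -- Dimension is a relation, because a basis of a subspace cannot in general
  -- be computed; over a field at most one d satisfies it.
  HasDimension : ∀ {ℓ} → Pred Vector ℓ → ℕ → Set (r ⊔ ℓr ⊔ m ⊔ ℓm ⊔ ℓ)
  HasDimension W d = ∃ λ (v : Fin d → Vector) → IsBasisOf W v

  Coordinate : ∀ {n} → (Fin n → Vector) → Subset n → Pred Vector (r ⊔ m ⊔ ℓm)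
  Coordinate e S = Span (λ x → ∃[ k ] k ∈ S × x ≈ᴹ e k)

  IsStrongBollobásᴹ : ∀ {ℓ} (t s : ℕ) {p : ℕ} (A B : Fin p → Pred Vector ℓ) →
                      Set (r ⊔ ℓr ⊔ m ⊔ ℓm ⊔ ℓ)
  IsStrongBollobásᴹ t s A B =
    (∀ i → ∃[ d ] HasDimension (A i ∩ₚ B i) d × d ≤ t) ×
    (∀ i j → i ≢ j → ∃[ d ] HasDimension (A i ∩ₚ B j) d × t + s < d)

{-# OPTIONS --safe #-}
module Submission where

-- Split a set of m (s + 1) points into m blocks of size s + 1, and add t
-- further points to all the sets: A i adds block i, and B i adds all the other
-- blocks.  The absorption identity for binomial coefficients makes every
-- weight equal to 1 / m.  The same index sets give the equality system of
-- coordinate subspaces of Fⁿ.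

open import Defs
open import Algebra.Apartness.Bundles using (HeytingField)
open import Algebra.Bundles using (CommutativeRing)
import Algebra.Construct.Pointwise as Pointwise
open import Algebra.Module.Bundles using (Module)
open import Algebra.Module.Structures.Biased using (IsModuleFromLeft)
import Algebra.Properties.CommutativeMonoid.Sum as CommutativeMonoidSum
open import Data.Bool.Base using (if_then_else_)
open import Data.Fin.Base using (Fin; zero; suc; punchIn)
open import Data.Fin.Properties using (_≟_; any?; punchInᵢ≢i; suc-injective)
open import Data.Fin.Subset using (Subset; inside; outside; _∈_; _∉_; _⊆_; _∩_; ∁; ⁅_⁆; ⊤; ⊥; ∣_∣)
open import Data.Fin.Subset.Properties
  using (∣⊤∣≡n; ∣⊥∣≡0; ∣⁅x⁆∣≡1; ∣∁p∣≡n∸∣p∣; ∩-idem; ∩-inverseʳ; x∈p∩q⁺; x∈p∩q⁻; x∈⁅y⁆⇒x≡y;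
         x≢y⇒x∉⁅y⁆; x∉p⇒x∈∁p; p⊆q⇒∣p∣≤∣q∣; _∈?_)
import Data.Integer.Base as ℤ
import Data.Integer.Properties as ℤ
open import Data.Nat.Base using (ℕ; zero; suc; _+_; _*_; _∸_; _≤_; _<_; z≤n; s≤s)
open import Data.Nat.Combinatorics using (_C_; nC1≡n; k>n⇒nCk≡0; nCk+nC[k+1]≡[n+1]C[k+1])
open import Data.Nat.Properties hiding (_≟_; suc-injective)
open import Data.Nat.Tactic.RingSolver using (solve-∀)
open import Data.Product.Base using (Σ-syntax; ∃-syntax; _×_; _,_)
open import Data.Rational.Base as ℚ using (1ℚ)
import Data.Rational.Properties as ℚ
open import Data.Rational.Unnormalised.Base as ℚᵘ using (mkℚᵘ; *≡*)
import Data.Rational.Unnormalised.Properties as ℚᵘ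
open import Data.Vec.Base using ([]; _∷_; _++_; concat; replicate; map; here; there)
open import Data.Vec.Properties using (zipWith-++; zipWith-replicate)
open import Function.Base using (_∘_; id)
open import Function.Definitions using (Injective)
open import Relation.Binary.PropositionalEquality
  using (_≡_; _≢_; refl; sym; trans; cong; cong₂; subst; module ≡-Reasoning)
open import Relation.Nullary using (yes; no; contradiction; does)
open import Relation.Unary using (Pred) renaming (_∩_ to _∩ₚ_)
open CommutativeMonoidSum ℚ.+-0-commutativeMonoid using (sum; sum-cong-≗)

-- Binomial coefficients

absorption : ∀ n k → suc k * (suc n C suc k) ≡ suc n * (n C k)
absorption n       zero    = begin
  1 * (suc n C 1)  ≡⟨ *-identityˡ (suc n C 1) ⟩
  suc n C 1        ≡⟨ nC1≡n (suc n) ⟩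
  suc n            ≡⟨ *-identityʳ (suc n) ⟨
  suc n * (n C 0)  ∎
  where open ≡-Reasoning
absorption zero    (suc k) = begin
  suc (suc k) * (1 C suc (suc k))  ≡⟨ cong (suc (suc k) *_) (k>n⇒nCk≡0 {1} {suc (suc k)} (s≤s (s≤s z≤n))) ⟩
  suc (suc k) * 0                  ≡⟨ *-zeroʳ (suc (suc k)) ⟩
  0                                ≡⟨ cong (1 *_) (k>n⇒nCk≡0 {0} {suc k} (s≤s z≤n)) ⟨
  1 * (0 C suc k)                  ∎
  where open ≡-Reasoning
absorption (suc n) (suc k) = begin
  K * (suc (suc n) C K)            ≡⟨ cong (K *_) (nCk+nC[k+1]≡[n+1]C[k+1] (suc n) (suc k)) ⟨
  K * (x + (suc n C K))            ≡⟨ *-distribˡ-+ K x (suc n C K) ⟩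
  -- `K * x` unfolds to `x + suc k * x`. Setting one `x` aside leaves exactly the left sides of the
  -- identity for `n` at `k` and at `suc k`; Pascal's rule then merges the two results into
  -- `suc n * x`.
  (x + suc k * x) + K * (suc n C K) ≡⟨ cong₂ (λ u v → (x + u) + v) (absorption n k) (absorption n (suc k)) ⟩
  (x + suc n * (n C k)) + suc n * (n C suc k)
                                   ≡⟨ +-assoc x _ _ ⟩
  x + (suc n * (n C k) + suc n * (n C suc k))
                                   ≡⟨ cong (x +_) (*-distribˡ-+ (suc n) (n C k) (n C suc k)) ⟨
  x + suc n * (n C k + n C suc k)  ≡⟨ cong (λ u → x + suc n * u) (nCk+nC[k+1]≡[n+1]C[k+1] n k) ⟩
  suc (suc n) * x                  ∎
  where
  open ≡-Reasoning
  K = suc (suc k)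
  x = suc n C suc k

-- Keeps the denominators away from the default value of `ratio` at zero. Writing the upper index as
-- `k + n` builds in that it is at least `k`, so Pascal's rule gives an induction on `k`.
[k+n]Ck>0 : ∀ k n → 0 < (k + n) C k
[k+n]Ck>0 zero    n = s≤s z≤n
[k+n]Ck>0 (suc k) n = begin-strict
  0                              <⟨ [k+n]Ck>0 k n ⟩
  (k + n) C k                    ≤⟨ m≤m+n _ _ ⟩
  (k + n) C k + (k + n) C suc k  ≡⟨ nCk+nC[k+1]≡[n+1]C[k+1] (k + n) k ⟩
  suc (k + n) C suc k            ∎
  where open ≤-Reasoning

-- Sums of equal fractions

/-homo-+ : ∀ i j n → (i ℚ./ suc n) ℚ.+ (j ℚ./ suc n) ≡ (i ℤ.+ j) ℚ./ suc n
/-homo-+ i j n = ℚ.toℚᵘ-injective (begin-equality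
  -- Fractions in `ℚ` are reduced to lowest terms, so the sum is compared among unnormalised
  -- rationals, where equality is cross-multiplication.
  ℚ.toℚᵘ ((i ℚ./ suc n) ℚ.+ (j ℚ./ suc n))           ≃⟨ ℚ.toℚᵘ-homo-+ (i ℚ./ suc n) (j ℚ./ suc n) ⟩
  ℚ.toℚᵘ (i ℚ./ suc n) ℚᵘ.+ ℚ.toℚᵘ (j ℚ./ suc n)     ≃⟨ ℚᵘ.+-cong (ℚ.toℚᵘ-fromℚᵘ (mkℚᵘ i n)) (ℚ.toℚᵘ-fromℚᵘ (mkℚᵘ j n)) ⟩
  mkℚᵘ i n ℚᵘ.+ mkℚᵘ j n                              ≃⟨ *≡* common-denominator ⟩
  mkℚᵘ (i ℤ.+ j) n                                    ≃⟨ ℚ.toℚᵘ-fromℚᵘ (mkℚᵘ (i ℤ.+ j) n) ⟨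
  ℚ.toℚᵘ ((i ℤ.+ j) ℚ./ suc n)                        ∎)
  where
  open ℚᵘ.≤-Reasoning
  d = ℤ.+ suc n
  common-denominator : (i ℤ.* d ℤ.+ j ℤ.* d) ℤ.* d ≡ (i ℤ.+ j) ℤ.* (d ℤ.* d)
  common-denominator = trans (cong (ℤ._* d) (sym (ℤ.*-distribʳ-+ d i j))) (ℤ.*-assoc (i ℤ.+ j) d d)

sum-/ : ∀ m p n → sum {m} (λ _ → ℤ.+ p ℚ./ suc n) ≡ ℤ.+ (m * p) ℚ./ suc n
-- The empty sum is 0 over 1, which still has to be identified with 0 over `suc n`; `mkℚᵘ` stores
-- the denominator minus one.
sum-/ zero    p n = ℚ.fromℚᵘ-cong {mkℚᵘ (ℤ.+ 0) 0} {mkℚᵘ (ℤ.+ 0) n} (*≡* refl)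
sum-/ (suc m) p n = trans (cong ((ℤ.+ p ℚ./ suc n) ℚ.+_) (sum-/ m p n)) (/-homo-+ (ℤ.+ p) (ℤ.+ (m * p)) n)

sum-ratio≡1 : ∀ m p q → m * p ≡ q → 0 < q → sum {m} (λ _ → ratio p q) ≡ 1ℚ
sum-ratio≡1 m p (suc n) mp≡q _ = begin
  sum {m} (λ _ → ℤ.+ p ℚ./ suc n)  ≡⟨ sum-/ m p n ⟩
  ℤ.+ (m * p) ℚ./ suc n            ≡⟨ cong (λ x → ℤ.+ x ℚ./ suc n) mp≡q ⟩
  ℤ.+ suc n ℚ./ suc n              ≡⟨ ℚ.fromℚᵘ-cong {mkℚᵘ (ℤ.+ suc n) n} {mkℚᵘ (ℤ.+ 1) 0} (*≡* (ℤ.*-comm (ℤ.+ suc n) (ℤ.+ 1))) ⟩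
  1ℚ                             ∎
  where open ≡-Reasoning

-- The weights of the block system

weightSum-cong : ∀ t s {m} {a a′ b b′ : Fin m → ℕ} → (∀ i → a i ≡ a′ i) → (∀ i → b i ≡ b′ i) →
                 weightSum t s a b ≡ weightSum t s a′ b′
weightSum-cong t s a≡a′ b≡b′ =
  sum-cong-≗ (λ i → cong₂ (weight t s) (a≡a′ i) (b≡b′ i))

-- After cancelling `t`, every weight is `(s + d) C s` over `suc (s + d) C suc s` with
-- `d = r * suc s`. Absorption makes this ratio `suc s` over `suc (s + d)`, that is, 1 over `suc r`.
-- The factor in `1 * suc s` is the number of blocks in the first set of a pair.
weightSum-blocks : ∀ t s r →
  weightSum t s {suc r} (λ _ → t + 1 * suc s) (λ _ → t + r * suc s) ≡ 1ℚ
weightSum-blocks t s r = begin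
  weightSum t s {suc r} (λ _ → t + 1 * k) (λ _ → t + d)
    ≡⟨⟩
  sum {suc r} (λ _ → ratio (((t + d ∸ t) + s) C s) (((t + 1 * k) + (t + d) ∸ 2 * t) C (t + 1 * k ∸ t)))
    ≡⟨ cong (λ w → sum {suc r} (λ _ → w))
         (cong₂ ratio (cong (_C s) numerator) (cong₂ _C_ total (trans (m+n∸m≡n t (1 * k)) (*-identityˡ k)))) ⟩
  sum {suc r} (λ _ → ratio ((s + d) C s) (suc (s + d) C k))
    ≡⟨ sum-ratio≡1 (suc r) _ _ (*-cancelˡ-≡ _ _ k scaled) ([k+n]Ck>0 k d) ⟩
  1ℚ ∎
  where
  open ≡-Reasoning
  k = suc s
  d = r * k
  numerator : (t + d ∸ t) + s ≡ s + d
  numerator = trans (cong (_+ s) (m+n∸m≡n t d)) (+-comm d s)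
  regroup : ∀ t k d → (t + 1 * k) + (t + d) ≡ 2 * t + (k + d)
  regroup = solve-∀
  total : (t + 1 * k) + (t + d) ∸ 2 * t ≡ suc (s + d)
  total = trans (cong (_∸ 2 * t) (regroup t k d)) (m+n∸m≡n (2 * t) (k + d))
  swap : ∀ x y z → (x * y) * z ≡ y * (x * z)
  swap = solve-∀
  -- `suc r * k` computes to `suc (s + d)`, so after `swap` this is absorption read backwards. The
  -- common factor `k` is cancelled by the caller.
  scaled : k * (suc r * ((s + d) C s)) ≡ k * (suc (s + d) C k)
  scaled = trans (sym (swap (suc r) k ((s + d) C s))) (sym (absorption (s + d) s))

-- Subsets made of blocks and common points

∣++∣ : ∀ {m n} (p : Subset m) (q : Subset n) → ∣ p ++ q ∣ ≡ ∣ p ∣ + ∣ q ∣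
∣++∣ []            q = refl
∣++∣ (inside  ∷ p) q = cong suc (∣++∣ p q)
∣++∣ (outside ∷ p) q = ∣++∣ p q

-- The union of the blocks of length `k` indexed by `p`. Repeating each membership bit `k` times
-- reduces intersections and cardinalities to those of index sets.
blowUp : ∀ k {m} → Subset m → Subset (m * k)
blowUp k p = concat (map (replicate k) p)

∣blowUp∣ : ∀ k {m} (p : Subset m) → ∣ blowUp k p ∣ ≡ ∣ p ∣ * k
∣blowUp∣ k []            = refl
∣blowUp∣ k (inside  ∷ p) = trans (∣++∣ (⊤ {k}) (blowUp k p)) (cong₂ _+_ (∣⊤∣≡n k) (∣blowUp∣ k p))
∣blowUp∣ k (outside ∷ p) = trans (∣++∣ (replicate k outside) (blowUp k p)) (cong₂ _+_ (∣⊥∣≡0 k) (∣blowUp∣ k p))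

blowUp-∩ : ∀ k {m} (p q : Subset m) → blowUp k p ∩ blowUp k q ≡ blowUp k (p ∩ q)
blowUp-∩ k []      []      = refl
blowUp-∩ k (x ∷ p) (y ∷ q) = trans
  (zipWith-++ _ (replicate k x) (blowUp k p) (replicate k y) (blowUp k q))
  (cong₂ _++_ (zipWith-replicate _ x y) (blowUp-∩ k p q))

-- The prefix `⊤` holds the `t` points common to all the sets of the system.
extend : ∀ t k {m} → Subset m → Subset (t + m * k)
extend t k p = ⊤ {t} ++ blowUp k p

∣extend∣ : ∀ t k {m} (p : Subset m) → ∣ extend t k p ∣ ≡ t + ∣ p ∣ * k
∣extend∣ t k p = trans (∣++∣ (⊤ {t}) (blowUp k p)) (cong₂ _+_ (∣⊤∣≡n t) (∣blowUp∣ k p))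

extend-∩ : ∀ t k {m} (p q : Subset m) → extend t k p ∩ extend t k q ≡ extend t k (p ∩ q)
extend-∩ t k p q = trans
  (zipWith-++ _ (⊤ {t}) (blowUp k p) (⊤ {t}) (blowUp k q))
  (cong₂ _++_ (∩-idem (⊤ {t})) (blowUp-∩ k p q))

-- The extremal set system

module Blocks (t s r : ℕ) where

  A B : Fin (suc r) → Subset (t + suc r * suc s)
  A i = extend t (suc s) ⁅ i ⁆
  B i = extend t (suc s) (∁ ⁅ i ⁆)

  ∣A∣ : ∀ i → ∣ A i ∣ ≡ t + 1 * suc s
  ∣A∣ i = trans (∣extend∣ t (suc s) ⁅ i ⁆) (cong (λ c → t + c * suc s) (∣⁅x⁆∣≡1 i))

  ∣B∣ : ∀ i → ∣ B i ∣ ≡ t + r * suc s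
  ∣B∣ i = trans (∣extend∣ t (suc s) (∁ ⁅ i ⁆))
    (cong (λ c → t + c * suc s) (trans (∣∁p∣≡n∸∣p∣ ⁅ i ⁆) (cong (suc r ∸_) (∣⁅x⁆∣≡1 i))))

  -- Reduces both intersection conditions to index sets: `⁅ i ⁆ ∩ ∁ ⁅ j ⁆` is empty when `i` equals
  -- `j` and contains `i` otherwise.
  ∣A∩B∣ : ∀ i j → ∣ A i ∩ B j ∣ ≡ t + ∣ ⁅ i ⁆ ∩ ∁ ⁅ j ⁆ ∣ * suc s
  ∣A∩B∣ i j = trans (cong ∣_∣ (extend-∩ t (suc s) ⁅ i ⁆ (∁ ⁅ j ⁆))) (∣extend∣ t (suc s) (⁅ i ⁆ ∩ ∁ ⁅ j ⁆))

  isStrongBollobás : IsStrongBollobás t s A B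
  isStrongBollobás = diagonal , offDiagonal
    where
    open ≤-Reasoning
    diagonal : ∀ i → ∣ A i ∩ B i ∣ ≤ t
    diagonal i = begin
      ∣ A i ∩ B i ∣                     ≡⟨ ∣A∩B∣ i i ⟩
      t + ∣ ⁅ i ⁆ ∩ ∁ ⁅ i ⁆ ∣ * suc s   ≡⟨ cong (λ p → t + ∣ p ∣ * suc s) (∩-inverseʳ ⁅ i ⁆) ⟩
      t + ∣ ⊥ {suc r} ∣ * suc s           ≡⟨ cong (λ c → t + c * suc s) (∣⊥∣≡0 (suc r)) ⟩
      t + 0                             ≡⟨ +-identityʳ t ⟩
      t                                 ∎
    ⁅i⁆⊆ : ∀ {i j} → i ≢ j → ⁅ i ⁆ ⊆ ⁅ i ⁆ ∩ ∁ ⁅ j ⁆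
    ⁅i⁆⊆ {i} {j} i≢j x∈⁅i⁆ with refl ← x∈⁅y⁆⇒x≡y i x∈⁅i⁆ = x∈p∩q⁺ (x∈⁅i⁆ , x∉p⇒x∈∁p (x≢y⇒x∉⁅y⁆ i≢j))
    offDiagonal : ∀ i j → i ≢ j → t + s < ∣ A i ∩ B j ∣
    offDiagonal i j i≢j = begin-strict
      -- Here the block size matters: one whole block of `suc s` points is just enough to exceed
      -- `t + s`.
      t + s                            <⟨ +-monoʳ-< t (n<1+n s) ⟩
      t + suc s                        ≡⟨ cong (t +_) (*-identityˡ (suc s)) ⟨
      t + 1 * suc s                    ≡⟨ cong (λ c → t + c * suc s) (∣⁅x⁆∣≡1 i) ⟨
      t + ∣ ⁅ i ⁆ ∣ * suc s            ≤⟨ +-monoʳ-≤ t (*-monoˡ-≤ (suc s) (p⊆q⇒∣p∣≤∣q∣ (⁅i⁆⊆ i≢j))) ⟩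
      t + ∣ ⁅ i ⁆ ∩ ∁ ⁅ j ⁆ ∣ * suc s  ≡⟨ ∣A∩B∣ i j ⟨
      ∣ A i ∩ B j ∣                    ∎

  weightSum≡1 : weightSum t s (λ i → ∣ A i ∣) (λ i → ∣ B i ∣) ≡ 1ℚ
  weightSum≡1 = trans (weightSum-cong t s ∣A∣ ∣B∣) (weightSum-blocks t s r)

-- Increasing enumeration of a subset

elements : ∀ {n} (p : Subset n) → Fin ∣ p ∣ → Fin n
elements (inside  ∷ p) zero    = zero
elements (inside  ∷ p) (suc j) = suc (elements p j)
elements (outside ∷ p) j       = suc (elements p j)

elements-injective : ∀ {n} (p : Subset n) → Injective _≡_ _≡_ (elements p)
elements-injective (inside  ∷ p) {zero}  {zero}  _  = refl
elements-injective (inside  ∷ p) {suc _} {suc _} eq = cong suc (elements-injective p (suc-injective eq))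
elements-injective (outside ∷ p)                 eq = elements-injective p (suc-injective eq)

elements-∈ : ∀ {n} (p : Subset n) j → elements p j ∈ p
elements-∈ (inside  ∷ p) zero    = here
elements-∈ (inside  ∷ p) (suc j) = there (elements-∈ p j)
elements-∈ (outside ∷ p) j       = there (elements-∈ p j)

elements-surjective : ∀ {n} (p : Subset n) {x} → x ∈ p → ∃[ j ] elements p j ≡ x
elements-surjective (inside  ∷ p) here        = zero , refl
elements-surjective (inside  ∷ p) (there x∈p) with j , refl ← elements-surjective p x∈p = suc j , refl
elements-surjective (outside ∷ p) (there x∈p) with j , refl ← elements-surjective p x∈p = j , refl

-- Coordinate subspaces of Kⁿ

module CoordinateSpace {c ℓ} (K : CommutativeRing c ℓ) (n : ℕ) where

  private
    module K = CommutativeRing K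
    open K using (0#; 1#; _≈_)
    open CommutativeMonoidSum K.+-commutativeMonoid
      using (sum-remove; sum-cong-≋; sum-replicate-zero) renaming (sum to Σ)

  space : Module K c ℓ
  space = record
    { Carrierᴹ = Fin n → K.Carrier
    ; _≈ᴹ_     = λ x y → ∀ k → x k ≈ y k
    ; _+ᴹ_     = λ x y k → x k K.+ y k
    ; _*ₗ_     = λ a x k → a K.* x k
    ; _*ᵣ_     = λ x a k → a K.* x k
    ; 0ᴹ       = λ _ → 0#
    ; -ᴹ_      = λ x k → K.- x k
    ; isModule = IsModuleFromLeft.isModule (record { isLeftModule = record
        { isLeftSemimodule = record
          { +ᴹ-isCommutativeMonoid = Pointwise.isCommutativeMonoid (Fin n) K.+-isCommutativeMonoid
          ; isPreleftSemimodule = record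
            { *ₗ-cong      = λ a≈b x≈y k → K.*-cong a≈b (x≈y k)
            ; *ₗ-zeroˡ     = λ x k → K.zeroˡ (x k)
            ; *ₗ-distribʳ  = λ x a b k → K.distribʳ (x k) a b
            ; *ₗ-identityˡ = λ x k → K.*-identityˡ (x k)
            ; *ₗ-assoc     = λ a b x k → K.*-assoc a b (x k)
            ; *ₗ-zeroʳ     = λ a k → K.zeroʳ a
            ; *ₗ-distribˡ  = λ a x y k → K.distribˡ a (x k) (y k)
            }
          }
        ; -ᴹ‿cong    = λ x≈y k → K.-‿cong (x≈y k)
        ; -ᴹ‿inverse = (λ x k → K.-‿inverseˡ (x k)) , (λ x k → K.-‿inverseʳ (x k))
        } })
    }

  open Module space using (_≈ᴹ_; 0ᴹ) renaming (Carrierᴹ to Vector)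
  open LinearAlgebra space

  unit : Fin n → Vector
  unit i k = if does (i ≟ k) then 1# else 0#

  unit-diagonal : ∀ i → unit i i ≈ 1#
  unit-diagonal i with i ≟ i
  ... | yes _   = K.refl
  ... | no i≢i = contradiction refl i≢i

  unit-offDiagonal : ∀ {i k} → i ≢ k → unit i k ≈ 0#
  unit-offDiagonal {i} {k} i≢k with i ≟ k
  ... | yes i≡k = contradiction i≡k i≢k
  ... | no _    = K.refl

  sum-zero : ∀ {d} {x : Fin d → K.Carrier} → (∀ j → x j ≈ 0#) → Σ x ≈ 0#
  sum-zero {d} x≈0 = K.trans (sum-cong-≋ x≈0) (sum-replicate-zero d)

  sum-single : ∀ {d} (x : Fin d → K.Carrier) i → (∀ j → j ≢ i → x j ≈ 0#) → Σ x ≈ x i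
  sum-single {suc d} x i x≈0 = K.trans (sum-remove {i = i} x)
    (K.trans (K.+-congˡ (sum-zero (λ j → x≈0 (punchIn i j) (punchInᵢ≢i i j)))) (K.+-identityʳ (x i)))

  -- Addition and scaling are pointwise, so taking a coordinate commutes with the sum. This turns
  -- vector sums into scalar sums.
  linearCombination-apply : ∀ {d} α (v : Fin d → Vector) k →
                            linearCombination α v k ≡ Σ (λ j → α j K.* v j k)
  linearCombination-apply {zero}  α v k = refl
  linearCombination-apply {suc d} α v k =
    cong ((α zero K.* v zero k) K.+_) (linearCombination-apply (α ∘ suc) (v ∘ suc) k)

  linearCombination-zero : ∀ {d} α (v : Fin d → Vector) {k} → (∀ j → v j k ≈ 0#) →
                           linearCombination α v k ≈ 0#
  linearCombination-zero α v {k} v≈0 = K.trans (K.reflexive (linearCombination-apply α v k))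
    (sum-zero (λ j → K.trans (K.*-congˡ (v≈0 j)) (K.zeroʳ (α j))))

  -- Since `f` is injective, only the summand at `i` is nonzero in coordinate `f i`, so that
  -- coordinate reads off the coefficient.
  linearCombination-unit : ∀ {d} α (f : Fin d → Fin n) → Injective _≡_ _≡_ f → ∀ i →
                           linearCombination α (unit ∘ f) (f i) ≈ α i
  linearCombination-unit α f f-injective i = K.trans
    (K.reflexive (linearCombination-apply α (unit ∘ f) (f i)))
    (K.trans
      (sum-single _ i (λ j j≢i → K.trans (K.*-congˡ (unit-offDiagonal (j≢i ∘ f-injective))) (K.zeroʳ (α j))))
      (K.trans (K.*-congˡ (unit-diagonal (f i))) (K.*-identityʳ (α i))))

  -- Reading off coordinates gives both halves: a vanishing combination has vanishing coefficients,
  -- and a vector of `W` is the combination whose coefficients are its own coordinates along `f`,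
  -- because its other coordinates are zero.
  units-isBasisOf : ∀ {w d} {W : Pred Vector w} (f : Fin d → Fin n) → Injective _≡_ _≡_ f →
                    (∀ j → W (unit (f j))) →
                    (∀ {x} → W x → ∀ k → (∀ j → f j ≢ k) → x k ≈ 0#) →
                    IsBasisOf W (unit ∘ f)
  units-isBasisOf {d = d} {W} f f-injective unit∈W vanishes = unit∈W , independent , spanning
    where
    independent : LinearlyIndependent (unit ∘ f)
    independent α ≈0 j = K.trans (K.sym (linearCombination-unit α f f-injective j)) (≈0 (f j))
    expansion : ∀ {x} → W x → x ≈ᴹ linearCombination (x ∘ f) (unit ∘ f)
    expansion {x} x∈W k with any? (λ j → f j ≟ k)
    ... | yes (j , refl) = K.sym (linearCombination-unit (x ∘ f) f f-injective j)
    ... | no ∄j = K.trans (vanishes x∈W k fj≢k)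
        (K.sym (linearCombination-zero (x ∘ f) (unit ∘ f) (unit-offDiagonal ∘ fj≢k)))
      where
      fj≢k : ∀ j → f j ≢ k
      fj≢k j fj≡k = ∄j (j , fj≡k)
    spanning : ∀ x → W x → Span (Range (unit ∘ f)) x
    spanning x x∈W = d , x ∘ f , unit ∘ f , (λ j → j , λ _ → K.refl) , expansion x∈W

  unit-isBasis : IsBasis unit
  -- With `f = id` every coordinate is in the image, so the vanishing condition is vacuous.
  unit-isBasis = units-isBasisOf id id _ (λ _ k j≢k → contradiction refl (j≢k k))

  unit∈coordinate : ∀ {S k} → k ∈ S → Coordinate unit S (unit k)
  unit∈coordinate {k = k} k∈S =
    1 , (λ _ → 1#) , (λ _ → unit k) , (λ _ → k , k∈S , λ _ → K.refl) ,
    λ i → K.sym (K.trans (K.+-identityʳ _) (K.*-identityˡ _))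

  coordinate-vanishes : ∀ {S x k} → Coordinate unit S x → k ∉ S → x k ≈ 0#
  coordinate-vanishes {S} {k = k} (d , α , v , v∈ , x≈) k∉S =
    K.trans (x≈ k) (linearCombination-zero α v v≈0)
    where
    v≈0 : ∀ j → v j k ≈ 0#
    v≈0 j with i , i∈S , v≈ ← v∈ j =
      K.trans (v≈ k) (unit-offDiagonal (λ i≡k → k∉S (subst (_∈ S) i≡k i∈S)))

  -- Stated for any predicate `W` so that it covers a coordinate subspace and an intersection of two
  -- alike, without rewriting the intersection as a span. The basis is indexed by `elements S`,
  -- which makes its length `∣ S ∣`.
  hasDimension-∣∣ : ∀ {w} {W : Pred Vector w} (S : Subset n) → (∀ {k} → k ∈ S → W (unit k)) →
                    (∀ {x k} → W x → k ∉ S → x k ≈ 0#) → HasDimension W ∣ S ∣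
  hasDimension-∣∣ S unit∈W vanishes = unit ∘ elements S ,
    units-isBasisOf (elements S) (elements-injective S) (λ j → unit∈W (elements-∈ S j))
      (λ x∈W k ∉image → vanishes x∈W λ k∈S → let j , eq = elements-surjective S k∈S in ∉image j eq)

  coordinate-dimension : ∀ S → HasDimension (Coordinate unit S) ∣ S ∣
  coordinate-dimension S = hasDimension-∣∣ S unit∈coordinate coordinate-vanishes

  coordinate-∩-dimension : ∀ S T → HasDimension (Coordinate unit S ∩ₚ Coordinate unit T) ∣ S ∩ T ∣
  coordinate-∩-dimension S T = hasDimension-∣∣ (S ∩ T)
    (λ k∈S∩T → let k∈S , k∈T = x∈p∩q⁻ S T k∈S∩T in unit∈coordinate k∈S , unit∈coordinate k∈T)
    vanishes
    where
    vanishes : ∀ {x k} → (Coordinate unit S ∩ₚ Coordinate unit T) x → k ∉ S ∩ T → x k ≈ 0#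
    -- A coordinate outside `S ∩ T` lies outside `S` or outside `T`; deciding membership in `S`
    -- tells which subspace forces it to vanish.
    vanishes {k = k} (x∈S , x∈T) k∉S∩T with k ∈? S
    ... | no k∉S  = coordinate-vanishes x∈S k∉S
    ... | yes k∈S = coordinate-vanishes x∈T (λ k∈T → k∉S∩T (x∈p∩q⁺ (k∈S , k∈T)))

  coordinate-isStrongBollobás : ∀ {t s m} {A B : Fin m → Subset n} → IsStrongBollobás t s A B →
    IsStrongBollobásᴹ t s (λ i → Coordinate unit (A i)) (λ i → Coordinate unit (B i))
  coordinate-isStrongBollobás {A = A} {B} (diagonal , offDiagonal) =
    (λ i → ∣ A i ∩ B i ∣ , coordinate-∩-dimension (A i) (B i) , diagonal i) ,
    (λ i j i≢j → ∣ A i ∩ B j ∣ , coordinate-∩-dimension (A i) (B j) , offDiagonal i j i≢j)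

proposition5p2 : ∀ {c ℓ₁ ℓ₂} (t s m : ℕ) → 2 ≤ m →
    (∃[ n ] Σ[ A ∈ (Fin m → Subset n) ] Σ[ B ∈ (Fin m → Subset n) ]
    IsStrongBollobás t s A B ×
    weightSum t s (λ i → ∣ A i ∣) (λ i → ∣ B i ∣) ≡ 1ℚ)
    ×
    ((F : HeytingField c ℓ₁ ℓ₂) →
    Σ[ V ∈ Module (fieldRing F) c ℓ₁ ]
    ∃[ n ] Σ[ e ∈ (Fin n → Module.Carrierᴹ V) ] LinearAlgebra.IsBasis V e ×
    (Σ[ S ∈ (Fin m → Subset n) ] Σ[ T ∈ (Fin m → Subset n) ]
    Σ[ a ∈ (Fin m → ℕ) ] Σ[ b ∈ (Fin m → ℕ) ]
    (∀ i → LinearAlgebra.HasDimension V (LinearAlgebra.Coordinate V e (S i)) (a i)) ×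
    (∀ i → LinearAlgebra.HasDimension V (LinearAlgebra.Coordinate V e (T i)) (b i)) ×
    LinearAlgebra.IsStrongBollobásᴹ V t s (λ i → LinearAlgebra.Coordinate V e (S i)) (λ i → LinearAlgebra.Coordinate V e (T i)) ×
    weightSum t s a b ≡ 1ℚ))
-- The bound `2 ≤ m` excludes `m = zero`. The index sets `A` and `B` serve both halves, and the
-- dimensions supplied are their cardinalities, so `weightSum≡1` proves both equalities.
proposition5p2 t s (suc r) _ =
  (n , A , B , isStrongBollobás , weightSum≡1) ,
  λ F → let open CoordinateSpace (fieldRing F) n in
    space , n , unit , unit-isBasis , A , B , (λ i → ∣ A i ∣) , (λ i → ∣ B i ∣) ,
    (λ i → coordinate-dimension (A i)) , (λ i → coordinate-dimension (B i)) ,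
    coordinate-isStrongBollobás isStrongBollobás , weightSum≡1
  where
  open Blocks t s r
  n = t + suc r * suc s
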